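{- Let $K$ be a perfect field, $f$ an irreducible polynomial over $K$ with set of roots $R\subset\bar K$, and let $B=\{\beta_1,\beta_2,\dots,\beta_m\}\subset R$ be a set of $m$ distinct roots. (1) $B$ is a minimal generating set of the splitting field of $f$ over $K$ if and only if for every permutation $(i_1,i_2,\dots,i_m)$ of $(1,2,\dots,m)$, the chain $$K\subseteq K(\beta_{i_1})\subseteq K(\beta_{i_1},\beta_{i_2})\subseteq\dots\subseteq K(\beta_{i_1},\beta_{i_2},\dots,\beta_{i_m})$$ is a cluster tower for $f$ of length $m$. In this case any such cluster tower is called a minimal cluster tower. (2) If $B$ is a minimal generating set of the splitting field of $f$ over $K$, then the $m!$ minimal cluster towers obtained from the $m!$ permutations in (1) are pairwise distinct; in other words, $B$ has $m!$ minimal cluster towers associated with it. (3) $B$ is a shortest minimal generating set of the splitting field of $f$ over $K$ if and only if $$K\subseteq K(\beta_1)\subseteq K(\beta_1,\beta_2)\subseteq\dots\subseteq K(\beta_1,\beta_2,\dots,\beta_m)$$ is a cluster tower for $f$ of length $m$ and $m$ is the least possible length of any cluster tower for $f$.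
   Context: $\bar K$ is a fixed algebraic closure of $K$, $K_f\subset\bar K$ is the splitting field of $f$, and $K(B)$ is the field generated over $K$ by $B$. Minimal generating set: $B\subset R$ is a minimal generating set of the splitting field of $f$ over $K$ if $K(B)=K_f$ and $K(A)\neq K_f$ for every $A\subsetneq B$. It is a shortest minimal generating set if it is a minimal generating set of least possible cardinality. Clusters: roots $\alpha,\beta\in R$ are equivalent if $K(\alpha)=K(\beta)$ (equality of subfields of $\bar K$); the equivalence classes are the root clusters of $f$, and $s_K(f)$ is their number. Cluster towers: for an ordering $(\beta_1,\dots,\beta_s)$, $s=s_K(f)$, of a complete set of representatives of the clusters, the chain $K\subseteq K(\beta_1)\subseteq K(\beta_1,\beta_2)\subseteq\dots\subseteq K(\beta_1,\dots,\beta_s)=K_f$ is a cluster tower of $f$. More generally, a chain $K\subseteq K(\gamma_1)\subseteq K(\gamma_1,\gamma_2)\subseteq\dots\subseteq K(\gamma_1,\dots,\gamma_m)$ with $\gamma_1,\dots,\gamma_m$ distinct roots of $f$ is regarded as a cluster tower for $f$ exactly when it terminates at the splitting field, i.e. $K(\gamma_1,\dots,\gamma_m)=K_f$. The length of a cluster tower is the number of strict inclusions in it. Two minimal cluster towers are equal if their fields are equal at each step, and distinct otherwise. -}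

module Defs where

open import Level using (Level; _⊔_)
open import Algebra.Bundles using (CommutativeRing; RawSemiring)
open import Algebra.Morphism.Structures using (IsRingMonomorphism)
import Algebra.Definitions.RawSemiring as SemiringDefinitions
open import Data.Fin.Base as Fin using (Fin; inject₁; fromℕ; toℕ)
open import Data.Fin.Permutation using (Permutation′; _⟨$⟩ʳ_)
import Data.Fin.Subset as FinSubset
open import Data.List.Base using (List; []; _∷_; map)
open import Data.Nat.Base as ℕ using (ℕ; zero; suc)
open import Data.Product.Base using (∃-syntax; Σ-syntax; _×_; proj₁)
open import Function.Base using (_∘_)
open import Function.Bundles using (_⇔_)
open import Function.Definitions using (Injective)
open import Relation.Binary.Bundles using (Setoid)
open import Relation.Binary.Core using (Rel)
open import Relation.Binary.Definitions using (_Respects_)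
open import Relation.Binary.PropositionalEquality.Core using (_≡_)
open import Relation.Nullary.Negation.Core using (¬_)
open import Relation.Unary using (Pred; _∈_; _⊆_; _⊂_; _≐_)
open import Relation.Unary.Properties using (≐-refl; ≐-sym; ≐-trans)

record Field c ℓ : Set (Level.suc (c ⊔ ℓ)) where
  field
    commutativeRing : CommutativeRing c ℓ

  open CommutativeRing commutativeRing public

  field
    0≉1     : ¬ (0# ≈ 1#)
    inverse : ∀ x → ¬ (x ≈ 0#) → ∃[ y ] x * y ≈ 1#

-- Univariate polynomials as coefficient lists, constant term first.  Lists may
-- carry trailing zeros, so polynomials are compared coefficientwise.
module Polynomial {c ℓ} (R : CommutativeRing c ℓ) where
  open CommutativeRing R

  Poly : Set c
  Poly = List Carrier

  coeff : Poly → ℕ → Carrier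
  coeff []      _       = 0#
  coeff (a ∷ p) zero    = a
  coeff (a ∷ p) (suc n) = coeff p n

  infix 4 _≈ₚ_
  _≈ₚ_ : Rel Poly ℓ
  p ≈ₚ q = ∀ n → coeff p n ≈ coeff q n

  infixl 6 _+ₚ_
  _+ₚ_ : Poly → Poly → Poly
  []      +ₚ q       = q
  (a ∷ p) +ₚ []      = a ∷ p
  (a ∷ p) +ₚ (b ∷ q) = (a + b) ∷ (p +ₚ q)

  infixl 7 _*ₚ_
  _*ₚ_ : Poly → Poly → Poly
  []      *ₚ q = []
  (a ∷ p) *ₚ q = map (a *_) q +ₚ (0# ∷ (p *ₚ q))

  polyRawSemiring : RawSemiring c ℓ
  polyRawSemiring = record
    { Carrier = Poly
    ; _≈_     = _≈ₚ_
    ; _+_     = _+ₚ_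
    ; _*_     = _*ₚ_
    ; 0#      = []
    ; 1#      = 1# ∷ []
    }

  open SemiringDefinitions polyRawSemiring public using (_∣_; Irreducible)

  eval : Poly → Carrier → Carrier
  eval []      x = 0#
  eval (a ∷ p) x = a + x * eval p x

  NonZero : Poly → Set ℓ
  NonZero p = ∃[ n ] ¬ (coeff p n ≈ 0#)

  NonConstant : Poly → Set ℓ
  NonConstant p = ∃[ n ] ¬ (coeff p (suc n) ≈ 0#)

  X-_ : Carrier → Poly
  X- x = (- x) ∷ 1# ∷ []

record AlgebraicClosure {a ℓ₁} (K : Field a ℓ₁) b ℓ₂ :
       Set (a ⊔ ℓ₁ ⊔ Level.suc (b ⊔ ℓ₂)) where
  private module K = Field K
  field
    extension : Field b ℓ₂

  open Field extension public

  open Polynomial K.commutativeRing public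
    using () renaming (Poly to K[X]; Irreducible to IrreducibleOverK)
  open Polynomial commutativeRing public
    using (_∣_; _*ₚ_; X-_; eval) renaming (Poly to K̄[X])

  field
    ι             : K.Carrier → Carrier
    isEmbedding   : IsRingMonomorphism K.rawRing rawRing ι
    algebraic     : ∀ x → ∃[ p ] Polynomial.NonZero K.commutativeRing p
                                 × eval (map ι p) x ≈ 0#
    closed        : ∀ p → Polynomial.NonConstant commutativeRing p →
                    ∃[ x ] eval p x ≈ 0#

module InClosure {a ℓ₁ b ℓ₂} {K : Field a ℓ₁} (K̄ : AlgebraicClosure K b ℓ₂) where
  open AlgebraicClosure K̄

  Separable : K[X] → Set (b ⊔ ℓ₂)
  Separable p = ∀ x → ¬ (((X- x) *ₚ (X- x)) ∣ map ι p)

  Perfect : Set (a ⊔ ℓ₁ ⊔ b ⊔ ℓ₂)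
  Perfect = ∀ p → IrreducibleOverK p → Separable p

  Roots : K[X] → Pred Carrier ℓ₂
  Roots f x = eval (map ι f) x ≈ 0#

  -- K⟨ B ⟩ is the subfield K(B).  The constants 0 and 1 come from `base`; `inv`
  -- says that the inverse of any invertible (i.e. nonzero) element is included.
  data K⟨_⟩ (B : Pred Carrier ℓ₂) : Pred Carrier (a ⊔ b ⊔ ℓ₂) where
    base : ∀ k → ι k ∈ K⟨ B ⟩
    gen  : ∀ {x} → x ∈ B → x ∈ K⟨ B ⟩
    add  : ∀ {x y} → x ∈ K⟨ B ⟩ → y ∈ K⟨ B ⟩ → x + y ∈ K⟨ B ⟩
    neg  : ∀ {x} → x ∈ K⟨ B ⟩ → - x ∈ K⟨ B ⟩
    mul  : ∀ {x y} → x ∈ K⟨ B ⟩ → y ∈ K⟨ B ⟩ → x * y ∈ K⟨ B ⟩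
    inv  : ∀ {x y} → x * y ≈ 1# → x ∈ K⟨ B ⟩ → y ∈ K⟨ B ⟩
    resp : ∀ {x y} → x ≈ y → x ∈ K⟨ B ⟩ → y ∈ K⟨ B ⟩

  SplittingField : K[X] → Pred Carrier (a ⊔ b ⊔ ℓ₂)
  SplittingField f = K⟨ Roots f ⟩

  Image : ∀ {n} → (Fin n → Carrier) → Pred Carrier ℓ₂
  Image γ x = ∃[ i ] x ≈ γ i

  Distinct : ∀ {n} → (Fin n → Carrier) → Set ℓ₂
  Distinct γ = Injective _≡_ _≈_ γ

  HasCardinality : Pred Carrier ℓ₂ → ℕ → Set (b ⊔ ℓ₂)
  HasCardinality B n = Σ[ γ ∈ (Fin n → Carrier) ] Distinct γ × B ≐ Image γ

  -- A predicate on the carrier is a subset only if it is invariant under _≈_;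
  -- without this requirement on A, a "proper subset" could drop some names of an
  -- element of B while keeping the element itself.
  record IsMinimalGeneratingSet (f : K[X]) (B : Pred Carrier ℓ₂) :
         Set (a ⊔ b ⊔ Level.suc ℓ₂) where
    field
      ⊆-roots   : B ⊆ Roots f
      invariant : B Respects _≈_
      generates : K⟨ B ⟩ ≐ SplittingField f
      minimal   : ∀ (A : Pred Carrier ℓ₂) → A Respects _≈_ → A ⊂ B →
                  ¬ (K⟨ A ⟩ ≐ SplittingField f)

  record IsShortestMinimalGeneratingSet (f : K[X]) (B : Pred Carrier ℓ₂) :
         Set (a ⊔ b ⊔ Level.suc ℓ₂) where
    field
      isMinimalGeneratingSet : IsMinimalGeneratingSet f B
      size                   : ℕ
      hasSize                : HasCardinality B size
      shortest               : ∀ C n → IsMinimalGeneratingSet f C →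
                               HasCardinality C n → size ℕ.≤ n

  -- A chain F₀ ⊆ F₁ ⊆ … ⊆ Fₙ has n + 1 members and n inclusions.
  Chain : ℕ → Set (Level.suc (a ⊔ b ⊔ ℓ₂))
  Chain n = Fin (suc n) → Pred Carrier (a ⊔ b ⊔ ℓ₂)

  infix 4 _≋_
  _≋_ : ∀ {n} → Rel (Chain n) (a ⊔ b ⊔ ℓ₂)
  F ≋ G = ∀ j → F j ≐ G j

  -- The j-th member of `chain γ` is K(γ₁, …, γⱼ), generated by the first j of the
  -- elements; the 0-th is generated by no element, i.e. is K itself.
  chain : ∀ {n} → (Fin n → Carrier) → Chain n
  chain γ j = K⟨ (λ x → ∃[ i ] toℕ i ℕ.< toℕ j × x ≈ γ i) ⟩

  -- The length of a chain is the size of its set of strict inclusions.  It is a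
  -- relation because strictness of an inclusion of subfields is not decidable.
  HasLength : ∀ {n} → Chain n → ℕ → Set (a ⊔ b ⊔ ℓ₂)
  HasLength {n} F ℓ = Σ[ S ∈ FinSubset.Subset n ]
    (∀ i → (i FinSubset.∈ S) ⇔ (F (inject₁ i) ⊂ F (Fin.suc i)))
    × FinSubset.∣ S ∣ ≡ ℓ

  record IsClusterTower (f : K[X]) {n} (γ : Fin n → Carrier) : Set (a ⊔ b ⊔ ℓ₂) where
    field
      roots      : ∀ i → γ i ∈ Roots f
      distinct   : Distinct γ
      terminates : chain γ (fromℕ n) ≐ SplittingField f

  IsClusterTowerOfLength : K[X] → ∀ {n} → (Fin n → Carrier) → ℕ → Set (a ⊔ b ⊔ ℓ₂)
  IsClusterTowerOfLength f γ ℓ = IsClusterTower f γ × HasLength (chain γ) ℓ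

  IsLeastTowerLength : K[X] → ℕ → Set (a ⊔ b ⊔ ℓ₂)
  IsLeastTowerLength f m =
    (∃[ n ] Σ[ γ ∈ (Fin n → Carrier) ] IsClusterTowerOfLength f γ m) ×
    (∀ {n} (γ : Fin n → Carrier) ℓ → IsClusterTowerOfLength f γ ℓ → m ℕ.≤ ℓ)

  permute : ∀ {m} → (Fin m → Carrier) → Permutation′ m → (Fin m → Carrier)
  permute β π = β ∘ (π ⟨$⟩ʳ_)

  -- Meant for β enumerating a minimal generating set: these are the minimal
  -- cluster towers associated with that set.
  TowerOf : ∀ {m} → (Fin m → Carrier) → Set (Level.suc (a ⊔ b ⊔ ℓ₂))
  TowerOf {m} β = Σ[ F ∈ Chain m ] Σ[ π ∈ Permutation′ m ] F ≋ chain (permute β π)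

  towersOf : ∀ {m} → (Fin m → Carrier) → Setoid (Level.suc (a ⊔ b ⊔ ℓ₂)) (a ⊔ b ⊔ ℓ₂)
  towersOf β = record
    { Carrier       = TowerOf β
    ; _≈_           = λ T U → proj₁ T ≋ proj₁ U
    ; isEquivalence = record
      { refl  = λ j → ≐-refl
      ; sym   = λ e j → ≐-sym (e j)
      ; trans = λ e e′ j → ≐-trans (e j) (e′ j)
      }
    }

{-# OPTIONS --safe #-}

-- Only the generation structure of the roots matters: a set of roots that
-- generates the splitting field is minimal exactly when no βᵢ lies in the field
-- generated by the other βⱼ.  Then every inclusion of every ordered chain is
-- strict; conversely, an ordering that puts βᵢ last shows that βᵢ is not generated
-- by the others.  If two orderings first differ at step j, equality of the j-th
-- fields would put βᵢ, the new generator of one, in a field generated by others.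
-- For (3), the generators at the strict steps of a tower already generate the
-- splitting field, and discarding redundant ones leaves a minimal generating set.
--
-- Membership in a subfield is undecidable; case distinctions on it are made under
-- a double negation, which is harmless because the conclusions m ≤ ℓ and ⊥ are
-- stable.

module Submission where

open import Defs
open import Data.Bool.Base using (true; false)
open import Data.Fin.Base as Fin using (Fin; zero; suc; inject₁; fromℕ; toℕ; punchIn; combine; remQuot)
open import Data.Fin.Induction using (<-wellFounded; Acc; acc)
open import Data.Fin.Permutation using (Permutation′; _⟨$⟩ʳ_; _⟨$⟩ˡ_; inverseʳ; insert; remove; insert-punchIn; insert-remove) renaming (_≈_ to _≈ᵖ_; id to idᵖ)
open import Data.Fin.Properties using (_≟_; any?; toℕ<n; toℕ-inject₁; toℕ-fromℕ; toℕ-injective; ≤fromℕ; sequence; suc-injective; punchIn-injective; punchIn-punchOut; injective⇒≤; remQuot-combine; combine-remQuot)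
open import Data.Fin.Subset as FinSubset using (Subset; ∣_∣; ⊤)
import Data.Fin.Subset.Properties as FinSubset
open import Data.List.Base using ([]; _∷_; map)
open import Data.Nat.Base as ℕ using (ℕ; zero; suc; _!; s≤s⁻¹)
import Data.Nat.Properties as ℕ
open import Data.Product.Base using (_×_; _,_; proj₁; proj₂; ∃-syntax; Σ-syntax)
open import Data.Sum.Base using (inj₁; inj₂)
open import Data.Vec.Base using (_∷_; tabulate; here; there)
open import Data.Vec.Properties using (lookup∘tabulate; []=⇒lookup; lookup⇒[]=)
open import Effect.Monad using (RawMonad)
open import Function.Base using (_∘_; id)
open import Function.Bundles using (_⇔_; Bijection; Equivalence; Injection; mk⇔)
open import Function.Definitions using (Injective)
open import Function.Properties.Inverse using (↔⇒↣)
open import Level using (0ℓ; _⊔_)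
open import Relation.Binary.Definitions using (_Respects_)
open import Relation.Binary.PropositionalEquality.Core using (_≡_; _≢_; refl; sym; trans; cong; cong₂; subst)
open import Relation.Binary.PropositionalEquality.Properties using () renaming (setoid to ≡-setoid)
open import Relation.Nullary.Decidable using (Dec; yes; no; does; dec-true; decidable-stable; ¬¬-excluded-middle; _×-dec_)
open import Relation.Nullary.Negation using (¬_; contradiction; ¬¬-map; ¬¬-Monad)
open import Relation.Unary using (Pred; _∈_; _∉_; _⊆_; _⊂_; _≐_)

-- Permutations and subsets of Fin n

permutation-injective : ∀ {n} (π : Permutation′ n) → Injective _≡_ _≡_ (π ⟨$⟩ʳ_)
permutation-injective π = Injection.injective (↔⇒↣ π)

insert-self : ∀ {n} (i j : Fin (suc n)) (π : Permutation′ n) → insert i j π ⟨$⟩ʳ i ≡ j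
insert-self i j π with i ≟ i
... | yes _   = refl
... | no  i≢i = contradiction refl i≢i

-- A mixed-radix code: the leading digit is the image of `zero`, and the remainder codes the
-- permutation left once `zero` and its image are removed.
decode : ∀ n → Fin (n !) → Permutation′ n
decode zero    _ = idᵖ
decode (suc n) x = insert zero (proj₁ (remQuot {suc n} (n !) x)) (decode n (proj₂ (remQuot {suc n} (n !) x)))

decode-injective : ∀ n {x y} → decode n x ≈ᵖ decode n y → x ≡ y
decode-injective zero    {zero} {zero} _ = refl
decode-injective (suc n) {x} {y} eq = trans (sym (combine-remQuot {suc n} (n !) x))
  (trans (cong₂ combine i≡j (decode-injective n tail)) (combine-remQuot {suc n} (n !) y))
  where
  i j : Fin (suc n)
  i = proj₁ (remQuot {suc n} (n !) x)
  j = proj₁ (remQuot {suc n} (n !) y)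
  i≡j : i ≡ j
  i≡j = eq zero
  ρ σ : Permutation′ n
  ρ = decode n (proj₂ (remQuot {suc n} (n !) x))
  σ = decode n (proj₂ (remQuot {suc n} (n !) y))
  tail : ρ ≈ᵖ σ
  tail k = punchIn-injective i _ _
    (trans (sym (insert-punchIn zero i ρ k))
    (trans (eq (suc k))
    (trans (insert-punchIn zero j σ k)
           (cong (λ l → punchIn l (σ ⟨$⟩ʳ k)) (sym i≡j)))))

decode-surjective : ∀ n (π : Permutation′ n) → ∃[ x ] decode n x ≈ᵖ π
decode-surjective zero    π = zero , λ ()
decode-surjective (suc n) π with decode-surjective n (remove zero π)
... | x , eq = combine (π ⟨$⟩ʳ zero) x ,
  subst (λ (i , y) → insert zero i (decode n y) ≈ᵖ π) (sym (remQuot-combine (π ⟨$⟩ʳ zero) x))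
    λ k → trans (insert-cong k) (insert-remove zero π k)
  where
  insert-cong : insert zero (π ⟨$⟩ʳ zero) (decode n x) ≈ᵖ insert zero (π ⟨$⟩ʳ zero) (remove zero π)
  insert-cong zero    = refl
  insert-cong (suc k) = trans (insert-punchIn zero _ (decode n x) k)
    (trans (cong (punchIn _) (eq k)) (sym (insert-punchIn zero _ (remove zero π) k)))

-- The increasing enumeration of the members of `S`.
element : ∀ {n} (S : Subset n) → Fin ∣ S ∣ → Fin n
element (true  ∷ S) zero    = zero
element (true  ∷ S) (suc i) = suc (element S i)
element (false ∷ S) i       = suc (element S i)

element-injective : ∀ {n} (S : Subset n) → Injective _≡_ _≡_ (element S)
element-injective (true  ∷ S) {zero}  {zero}  _  = refl
element-injective (true  ∷ S) {suc _} {suc _} eq = cong suc (element-injective S (suc-injective eq))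
element-injective (false ∷ S) eq = element-injective S (suc-injective eq)

element-surjective : ∀ {n} (S : Subset n) {i} → i FinSubset.∈ S → ∃[ k ] i ≡ element S k
element-surjective (true  ∷ S) here = zero , refl
element-surjective (true  ∷ S) (there i∈S) with element-surjective S i∈S
... | k , refl = suc k , refl
element-surjective (false ∷ S) (there i∈S) with element-surjective S i∈S
... | k , refl = k , refl

decidable⇒subset : ∀ {n p} {P : Pred (Fin n) p} → (∀ i → Dec (P i)) →
                   Σ[ S ∈ Subset n ] (∀ i → (i FinSubset.∈ S) ⇔ P i)
decidable⇒subset {P = P} P? = S , λ i → mk⇔ (to i) (from i)
  where
  S = tabulate (does ∘ P?)
  to : ∀ i → i FinSubset.∈ S → P i
  to i i∈S with P? i | trans (sym (lookup∘tabulate (does ∘ P?) i)) ([]=⇒lookup i∈S)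
  ... | yes p | _ = p
  from : ∀ i → P i → i FinSubset.∈ S
  from i p = lookup⇒[]= i S (trans (lookup∘tabulate (does ∘ P?) i) (dec-true (P? i) p))

-- Finiteness of the index type lets an undecidable property be assumed at all indices at once.
¬¬-sequence : ∀ {n p} {P : Pred (Fin n) p} → (∀ i → ¬ ¬ P i) → ¬ ¬ (∀ i → P i)
¬¬-sequence = sequence (RawMonad.rawApplicative ¬¬-Monad)

module _ {a ℓ₁ b ℓ₂} {K : Field a ℓ₁} (K̄ : AlgebraicClosure K b ℓ₂) where
  open AlgebraicClosure K̄ using (Carrier; _≈_; K[X])
    renaming (refl to ≈-refl; sym to ≈-sym; trans to ≈-trans; reflexive to ≈-reflexive)
  open InClosure K̄

  -- Subfields generated by a family

  K⟨⟩-least : ∀ {B C} → B ⊆ K⟨ C ⟩ → K⟨ B ⟩ ⊆ K⟨ C ⟩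
  K⟨⟩-least h (base k)   = base k
  K⟨⟩-least h (gen x)    = h x
  K⟨⟩-least h (add x y)  = add (K⟨⟩-least h x) (K⟨⟩-least h y)
  K⟨⟩-least h (neg x)    = neg (K⟨⟩-least h x)
  K⟨⟩-least h (mul x y)  = mul (K⟨⟩-least h x) (K⟨⟩-least h y)
  K⟨⟩-least h (inv e x)  = inv e (K⟨⟩-least h x)
  K⟨⟩-least h (resp e x) = resp e (K⟨⟩-least h x)

  K⟨⟩-mono : ∀ {B C} → B ⊆ C → K⟨ B ⟩ ⊆ K⟨ C ⟩
  K⟨⟩-mono B⊆C = K⟨⟩-least (gen ∘ B⊆C)

  -- Generators are selected by index, so that `chain γ j` is by definition the span of the indices
  -- below `j`.
  span : ∀ {n} → (Fin n → Carrier) → Pred (Fin n) 0ℓ → Pred Carrier (a ⊔ b ⊔ ℓ₂)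
  span γ P = K⟨ (λ x → ∃[ i ] P i × x ≈ γ i) ⟩

  span-gen : ∀ {n} (γ : Fin n → Carrier) (P : Pred (Fin n) 0ℓ) {i} → P i → γ i ∈ span γ P
  span-gen γ P p = gen (_ , p , ≈-refl)

  span-least : ∀ {n} {γ : Fin n → Carrier} {P : Pred (Fin n) 0ℓ} {C} →
               (∀ i → P i → γ i ∈ K⟨ C ⟩) → span γ P ⊆ K⟨ C ⟩
  span-least h = K⟨⟩-least λ (i , p , x≈γi) → resp (≈-sym x≈γi) (h i p)

  span-mono : ∀ {n} {γ : Fin n → Carrier} {P Q : Pred (Fin n) 0ℓ} →
              (∀ i → P i → Q i) → span γ P ⊆ span γ Q
  span-mono {γ = γ} {Q = Q} h = span-least λ i p → span-gen γ Q (h i p)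

  Image-gen : ∀ {n} (γ : Fin n → Carrier) i → γ i ∈ K⟨ Image γ ⟩
  Image-gen γ i = gen (i , ≈-refl)

  Image-least : ∀ {n} {γ : Fin n → Carrier} {C} →
                (∀ i → γ i ∈ K⟨ C ⟩) → K⟨ Image γ ⟩ ⊆ K⟨ C ⟩
  Image-least h = K⟨⟩-least λ (i , x≈γi) → resp (≈-sym x≈γi) (h i)

  Image-permute : ∀ {n} (γ : Fin n → Carrier) (π : Permutation′ n) →
                  Image γ ≐ Image (permute γ π)
  Image-permute γ π =
    (λ (i , x≈γi) → π ⟨$⟩ˡ i , ≈-trans x≈γi (≈-reflexive (cong γ (sym (inverseʳ π))))) ,
    (λ (i , x≈γπi) → π ⟨$⟩ʳ i , x≈γπi)

  chain-step : ∀ {n} (γ : Fin n → Carrier) i → chain γ (inject₁ i) ⊆ chain γ (suc i)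
  chain-step γ i = span-mono λ j j<i → ℕ.m<n⇒m<1+n (subst (toℕ j ℕ.<_) (toℕ-inject₁ i) j<i)

  chain-⊆-Image : ∀ {n} (γ : Fin n → Carrier) j → chain γ j ⊆ K⟨ Image γ ⟩
  chain-⊆-Image γ j = span-least λ i _ → Image-gen γ i

  Image-⊆-chain : ∀ {n} (γ : Fin n → Carrier) → K⟨ Image γ ⟩ ⊆ chain γ (fromℕ n)
  Image-⊆-chain {n} γ = Image-least λ i →
    span-gen γ _ (subst (toℕ i ℕ.<_) (sym (toℕ-fromℕ n)) (toℕ<n i))

  -- Independent generating families

  -- Irredundancy stated on indices; it stands in for the quantifier over proper subsets in the
  -- definition of minimality.
  Independent : ∀ {n} → (Fin n → Carrier) → Set (a ⊔ b ⊔ ℓ₂)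
  Independent γ = ∀ i → γ i ∉ span γ (_≢ i)

  independent⇒strict : ∀ {n} {γ : Fin n → Carrier} → Independent γ →
                       ∀ i → chain γ (inject₁ i) ⊂ chain γ (suc i)
  independent⇒strict {γ = γ} ind i = chain-step γ i , λ ⊇ →
    ind i (span-mono (λ { j j<i refl → ℕ.<-irrefl (sym (toℕ-inject₁ i)) j<i })
                     (⊇ (span-gen γ _ (ℕ.n<1+n (toℕ i)))))

  -- All generators but one precede position `l`; if that one were generated by the others, the last
  -- inclusion would be an equality.
  strict-last⇒∉ : ∀ {n} (γ : Fin (suc n) → Carrier) (π : Permutation′ (suc n)) →
                  let l = fromℕ n in
                  chain (permute γ π) (inject₁ l) ⊂ chain (permute γ π) (suc l) →
                  γ (π ⟨$⟩ʳ l) ∉ span γ (_≢ π ⟨$⟩ʳ l)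
  strict-last⇒∉ {n} γ π (_ , ⊉) γl∈ = ⊉ (span-least λ j _ → collapse j)
    where
    l = fromℕ n
    earlier : ∀ j → j ≢ l → permute γ π j ∈ chain (permute γ π) (inject₁ l)
    earlier j j≢l = span-gen (permute γ π) _ (subst (toℕ j ℕ.<_) (sym (toℕ-inject₁ l))
      (ℕ.≤∧≢⇒< (≤fromℕ j) (j≢l ∘ toℕ-injective)))
    collapse : ∀ j → permute γ π j ∈ chain (permute γ π) (inject₁ l)
    collapse j with j ≟ l
    ... | no  j≢l  = earlier j j≢l
    -- An index other than `π ⟨$⟩ʳ l` is the image of a position other than `l`, so its generator is
    -- present before the last step.
    ... | yes refl = span-least (λ k k≢ → subst (λ k → γ k ∈ chain (permute γ π) (inject₁ l)) (inverseʳ π)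
                       (earlier (π ⟨$⟩ˡ k) λ eq → k≢ (trans (sym (inverseʳ π)) (cong (π ⟨$⟩ʳ_) eq)))) γl∈

  -- Strong induction on the position `i`: independence forces `π ⟨$⟩ʳ i` to be a value of `σ` at
  -- some position up to `i`. An earlier position is excluded by injectivity of `π`, since the
  -- orders already agree there.
  chains-determine-order : ∀ {n} {γ : Fin n → Carrier} → Independent γ → (π σ : Permutation′ n) →
                           chain (permute γ π) ≋ chain (permute γ σ) → π ≈ᵖ σ
  chains-determine-order {γ = γ} ind π σ eq i = go i (<-wellFounded i)
    where
    go : ∀ i → Acc Fin._<_ i → π ⟨$⟩ʳ i ≡ σ ⟨$⟩ʳ i
    go i (acc rs) with any? (λ j → (toℕ j ℕ.<? suc (toℕ i)) ×-dec (σ ⟨$⟩ʳ j ≟ π ⟨$⟩ʳ i))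
    ... | no none = contradiction
            (span-least (λ j j≤i → span-gen γ _ (λ σj≡πi → none (j , j≤i , σj≡πi)))
              (proj₁ (eq (suc i)) (span-gen (permute γ π) _ (ℕ.n<1+n (toℕ i)))))
            (ind (π ⟨$⟩ʳ i))
    ... | yes (j , j≤i , σj≡πi) with ℕ.m≤n⇒m<n∨m≡n (s≤s⁻¹ j≤i)
    ...   | inj₁ j<i = contradiction
              (cong toℕ (permutation-injective π (trans (go j (rs j<i)) σj≡πi))) (ℕ.<⇒≢ j<i)
    ...   | inj₂ j≡i = trans (sym σj≡πi) (cong (σ ⟨$⟩ʳ_) (toℕ-injective j≡i))

  ¬¬-hasLength : ∀ {n} (F : Chain n) → ¬ ¬ (∃[ ℓ ] ℓ ℕ.≤ n × HasLength F ℓ)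
  ¬¬-hasLength F = ¬¬-map
    (λ strict? → let (S , S⇔) = decidable⇒subset strict? in
                 ∣ S ∣ , FinSubset.∣p∣≤n S , S , S⇔ , refl)
    (¬¬-sequence λ i → ¬¬-excluded-middle {A = F (inject₁ i) ⊂ F (suc i)})

  -- A generator at a non-strict step lies in the field of its predecessors, so by strong induction
  -- it is generated by those at strict steps.
  strict-steps-generate : ∀ {n} (γ : Fin n → Carrier) (S : Subset n) →
    (∀ i → (i FinSubset.∈ S) ⇔ (chain γ (inject₁ i) ⊂ chain γ (suc i))) →
    ¬ ¬ (∀ i → γ i ∈ K⟨ Image (γ ∘ element S) ⟩)
  strict-steps-generate γ S S⇔ = ¬¬-map
    (λ redundant i → generated redundant i (<-wellFounded i))
    (¬¬-sequence redundant)
    where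
    redundant : ∀ i → ¬ ¬ (i FinSubset.∉ S → γ i ∈ chain γ (inject₁ i))
    redundant i ¬h = ¬h λ i∉S → contradiction
      -- The reverse inclusion would put `γ i` in the previous field, against `¬h`; so the step is
      -- strict and `i` belongs to `S`.
      (Equivalence.from (S⇔ i) (chain-step γ i , λ ⊇ → ¬h λ _ → ⊇ (span-gen γ _ (ℕ.n<1+n (toℕ i)))))
      i∉S
    generated : (∀ i → i FinSubset.∉ S → γ i ∈ chain γ (inject₁ i)) →
                ∀ i → Acc Fin._<_ i → γ i ∈ K⟨ Image (γ ∘ element S) ⟩
    generated h i (acc rs) with i FinSubset.∈? S
    ... | yes i∈S with element-surjective S i∈S
    ...   | k , refl = Image-gen (γ ∘ element S) k
    generated h i (acc rs) | no i∉S = span-least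
      (λ j j<i → generated h j (rs (subst (toℕ j ℕ.<_) (toℕ-inject₁ i) j<i))) (h i i∉S)

  -- Minimal generating sets and towers

  module _ (f : K[X]) where

    Generates : ∀ {n} → (Fin n → Carrier) → Set (a ⊔ b ⊔ ℓ₂)
    Generates γ = SplittingField f ⊆ K⟨ Image γ ⟩

    roots⇒⊆ : ∀ {n} {γ : Fin n → Carrier} → (∀ i → γ i ∈ Roots f) → K⟨ Image γ ⟩ ⊆ SplittingField f
    roots⇒⊆ rts = Image-least (gen ∘ rts)

    generates⇒tower : ∀ {n} {γ : Fin n → Carrier} → (∀ i → γ i ∈ Roots f) → Distinct γ →
                      Generates γ → IsClusterTower f γ
    generates⇒tower {γ = γ} rts dis gens = record
      { roots      = rts
      ; distinct   = dis
      ; terminates = roots⇒⊆ rts ∘ chain-⊆-Image γ _ , Image-⊆-chain γ ∘ gens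
      }

    tower⇒generates : ∀ {n} {γ : Fin n → Carrier} → IsClusterTower f γ → Generates γ
    tower⇒generates {γ = γ} T = chain-⊆-Image γ _ ∘ proj₂ (IsClusterTower.terminates T)

    -- Shrinks a generating family by one; the arguments about least size refute redundancy through
    -- it.
    redundant-generator : ∀ {n} {γ : Fin (suc n) → Carrier} i → Generates γ →
                          γ i ∈ span γ (_≢ i) → Generates (γ ∘ punchIn i)
    redundant-generator {γ = γ} i gens γi∈ = Image-least generated ∘ gens
      where
      others : ∀ j → j ≢ i → γ j ∈ K⟨ Image (γ ∘ punchIn i) ⟩
      others j j≢i = subst (λ k → γ k ∈ K⟨ Image (γ ∘ punchIn i) ⟩)
        (punchIn-punchOut (j≢i ∘ sym)) (Image-gen (γ ∘ punchIn i) _)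
      generated : ∀ j → γ j ∈ K⟨ Image (γ ∘ punchIn i) ⟩
      generated j with j ≟ i
      ... | no  j≢i  = others j j≢i
      ... | yes refl = span-least others γi∈

    minimal⇒independent : ∀ {n} {γ : Fin n → Carrier} → Distinct γ →
                          IsMinimalGeneratingSet f (Image γ) → Independent γ
    minimal⇒independent {γ = γ} dis M i γi∈ = minimal A
      (λ x≈y (j , j≢i , x≈γj) → j , j≢i , ≈-trans (≈-sym x≈y) x≈γj)
      ((λ (j , _ , x≈γj) → j , x≈γj) ,
       -- Distinctness makes `A` a proper subset: otherwise `γ i` would coincide with another member
       -- of the family.
       (λ ⊇ → let (j , j≢i , γi≈γj) = ⊇ (i , ≈-refl) in j≢i (sym (dis γi≈γj))))
      (proj₁ generates ∘ K⟨⟩-mono (λ (j , _ , x≈γj) → j , x≈γj) ,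
       Image-least generated ∘ proj₂ generates)
      where
      open IsMinimalGeneratingSet M
      A : Pred Carrier ℓ₂
      A x = ∃[ j ] j ≢ i × x ≈ γ j
      generated : ∀ j → γ j ∈ K⟨ A ⟩
      generated j with j ≟ i
      ... | no  j≢i  = span-gen γ _ j≢i
      ... | yes refl = γi∈

    -- Properness of `A` does not exhibit an omitted root. Instead, `γ i ∉ A` would put `γ i` in the
    -- field generated by the others, so up to double negation `A` omits nothing, against
    -- properness.
    independent⇒minimal : ∀ {n} {γ : Fin n → Carrier} → (∀ i → γ i ∈ Roots f) → Generates γ →
                          Independent γ → IsMinimalGeneratingSet f (Image γ)
    independent⇒minimal {γ = γ} rts gens ind = record
      { ⊆-roots   = λ (i , x≈γi) → Roots-resp (≈-sym x≈γi) (rts i)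
      ; invariant = λ x≈y (i , x≈γi) → i , ≈-trans (≈-sym x≈y) x≈γi
      ; generates = roots⇒⊆ rts , gens
      ; minimal   = λ A A-resp (A⊆ , A⊉) A-gen → ¬¬-sequence
          (λ i γi∉A → ind i (K⟨⟩-mono
            (λ {x} x∈A → let (j , x≈γj) = A⊆ x∈A in
              j , (λ { refl → γi∉A (A-resp x≈γj x∈A) }) , x≈γj)
            (proj₂ A-gen (gen (rts i)))))
          (λ γ∈A → A⊉ λ (i , x≈γi) → A-resp (≈-sym x≈γi) (γ∈A i))
      }
      where
      open AlgebraicClosure K̄ using (eval; ι; +-cong; *-cong)
      eval-cong : ∀ p {x y} → x ≈ y → eval p x ≈ eval p y
      eval-cong []      x≈y = ≈-refl
      eval-cong (c ∷ p) x≈y = +-cong ≈-refl (*-cong x≈y (eval-cong p x≈y))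
      Roots-resp : Roots f Respects _≈_
      Roots-resp x≈y fx≈0 = ≈-trans (eval-cong (map ι f) (≈-sym x≈y)) fx≈0

    minimal-resp-≐ : ∀ {B C} → B ≐ C → IsMinimalGeneratingSet f B → IsMinimalGeneratingSet f C
    minimal-resp-≐ (B⊆C , C⊆B) M = record
      { ⊆-roots   = ⊆-roots ∘ C⊆B
      ; invariant = λ x≈y → B⊆C ∘ invariant x≈y ∘ C⊆B
      ; generates = proj₁ generates ∘ K⟨⟩-mono C⊆B , K⟨⟩-mono B⊆C ∘ proj₂ generates
      ; minimal   = λ A A-resp (A⊆C , A⊉C) →
          minimal A A-resp (C⊆B ∘ A⊆C , λ B⊆A → A⊉C (B⊆A ∘ C⊆B))
      }
      where open IsMinimalGeneratingSet M

    minimal⇒tower : ∀ {n} {γ : Fin n → Carrier} → Distinct γ →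
                    IsMinimalGeneratingSet f (Image γ) → IsClusterTowerOfLength f γ n
    minimal⇒tower {n} dis M =
      generates⇒tower (λ i → ⊆-roots (i , ≈-refl)) dis (proj₂ generates) ,
      ⊤ , (λ i → mk⇔ (λ _ → independent⇒strict (minimal⇒independent dis M) i) (λ _ → FinSubset.∈⊤)) ,
      FinSubset.∣⊤∣≡n n
      where open IsMinimalGeneratingSet M

    minimal⇒tower-permuted : ∀ {n} {γ : Fin n → Carrier} → Distinct γ →
                             IsMinimalGeneratingSet f (Image γ) →
                             ∀ π → IsClusterTowerOfLength f (permute γ π) n
    minimal⇒tower-permuted {γ = γ} dis M π = minimal⇒tower
      (permutation-injective π ∘ dis) (minimal-resp-≐ (Image-permute γ π) M)

    -- Length `n` with only `n` inclusions makes each of them strict; this is applied to the last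
    -- step of an ordering that ends with `i`.
    towers⇒independent : ∀ {n} {γ : Fin n → Carrier} →
                         (∀ π → IsClusterTowerOfLength f (permute γ π) n) → Independent γ
    towers⇒independent {suc n} {γ} towers i = subst (λ k → γ k ∉ span γ (_≢ k)) (insert-self l i idᵖ)
      (strict-last⇒∉ γ i-last (Equivalence.to (S⇔ l) (subst (l FinSubset.∈_) (sym (FinSubset.∣p∣≡n⇒p≡⊤ ∣S∣≡n)) FinSubset.∈⊤)))
      where
      l      = fromℕ n
      i-last = insert l i idᵖ
      S⇔     = proj₁ (proj₂ (proj₂ (towers i-last)))
      ∣S∣≡n  = proj₂ (proj₂ (proj₂ (towers i-last)))

    -- Induction on `n`: if the bound failed, no generator could be redundant, since dropping it
    -- would already give the bound. The family would then be minimal, and `bound` would apply to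
    -- it.
    minimal-lower-bound : ∀ {m} →
      (∀ {k} {δ : Fin k → Carrier} → Distinct δ → IsMinimalGeneratingSet f (Image δ) → m ℕ.≤ k) →
      ∀ {n} {γ : Fin n → Carrier} → (∀ i → γ i ∈ Roots f) → Distinct γ → Generates γ → m ℕ.≤ n
    minimal-lower-bound {m} bound {n} rts dis gens = decidable-stable (m ℕ.≤? n) λ m≰n →
      m≰n (bound dis (independent⇒minimal rts gens (independent rts dis gens m≰n)))
      where
      independent : ∀ {n} {γ : Fin n → Carrier} → (∀ i → γ i ∈ Roots f) → Distinct γ →
                    Generates γ → ¬ (m ℕ.≤ n) → Independent γ
      independent {suc n} rts dis gens m≰1+n i γi∈ = m≰1+n (ℕ.m≤n⇒m≤1+n
        (minimal-lower-bound bound (rts ∘ punchIn i) (punchIn-injective i _ _ ∘ dis)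
          (redundant-generator i gens γi∈)))

    shortest⇒least : ∀ {m} {γ : Fin m → Carrier} → Distinct γ →
                     IsShortestMinimalGeneratingSet f (Image γ) → IsLeastTowerLength f m
    shortest⇒least {m} {γ} dis B =
      (m , γ , minimal⇒tower dis isMinimalGeneratingSet) , least
      where
      open IsShortestMinimalGeneratingSet B
      -- `size` comes with an enumeration `δ` of its own; matching indices of `γ` with those of `δ`
      -- is injective because `γ` is.
      m≤size : m ℕ.≤ size
      m≤size = let (δ , _ , γ⊆δ , _) = hasSize in
        injective⇒≤ {f = λ i → proj₁ (γ⊆δ (i , ≈-refl))} λ {i} {j} eq →
          dis (≈-trans (proj₂ (γ⊆δ (i , ≈-refl)))
              (≈-trans (≈-reflexive (cong δ eq)) (≈-sym (proj₂ (γ⊆δ (j , ≈-refl))))))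
      bound : ∀ {k} {δ : Fin k → Carrier} → Distinct δ → IsMinimalGeneratingSet f (Image δ) → m ℕ.≤ k
      bound {k} {δ} dδ M = ℕ.≤-trans m≤size (shortest (Image δ) k M (δ , dδ , id , id))
      least : ∀ {n} (δ : Fin n → Carrier) ℓ → IsClusterTowerOfLength f δ ℓ → m ℕ.≤ ℓ
      -- The generators at strict steps form a generating family of `∣ S ∣` distinct roots, to which
      -- the lower bound applies.
      least δ _ (T , S , S⇔ , refl) = decidable-stable (m ℕ.≤? ∣ S ∣) (¬¬-map
        (λ S-gen → minimal-lower-bound bound (roots ∘ element S)
          (element-injective S ∘ distinct) (Image-least S-gen ∘ tower⇒generates T))
        (strict-steps-generate δ S S⇔))
        where open IsClusterTower T

    least⇒shortest : ∀ {m} {γ : Fin m → Carrier} → IsClusterTower f γ → IsLeastTowerLength f m →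
                     IsShortestMinimalGeneratingSet f (Image γ)
    least⇒shortest {m} {γ} T (_ , least) = record
      { isMinimalGeneratingSet = independent⇒minimal roots (tower⇒generates T)
          (independent roots distinct (tower⇒generates T) ℕ.≤-refl)
      ; size     = m
      ; hasSize  = γ , distinct , id , id
      ; shortest = λ C n M (δ , dδ , C≐δ) → least δ n (minimal⇒tower dδ (minimal-resp-≐ C≐δ M))
      }
      where
      open IsClusterTower T
      independent : ∀ {n} {δ : Fin n → Carrier} → (∀ i → δ i ∈ Roots f) → Distinct δ →
                    Generates δ → n ℕ.≤ m → Independent δ
      -- Without `δ i` there remains a tower with `n` inclusions, whose length is at most `n` and
      -- hence below `m`.
      independent {suc n} {δ} rts dis gens n<m i δi∈ = ¬¬-hasLength (chain (δ ∘ punchIn i))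
        λ (ℓ , ℓ≤n , len) → ℕ.<⇒≱ n<m (ℕ.≤-trans (least (δ ∘ punchIn i) ℓ
          (generates⇒tower (rts ∘ punchIn i) (punchIn-injective i _ _ ∘ dis)
            (redundant-generator i gens δi∈) , len)) ℓ≤n)

  -- Makes the count exact: injectivity holds because the fields determine the order, surjectivity
  -- because each tower carries its permutation.
  towers-bijection : ∀ {n} {γ : Fin n → Carrier} → Independent γ →
                     Bijection (≡-setoid (Fin (n !))) (towersOf γ)
  towers-bijection {n} {γ} ind = record
    { to        = λ x → chain (permute γ (decode n x)) , decode n x , λ j → id , id
    ; cong      = λ { refl j → id , id }
    ; bijective =
        (λ {x} {y} eq → decode-injective n (chains-determine-order ind (decode n x) (decode n y) eq)) ,
        (λ (F , π , F≋π) → let (x , x≈π) = decode-surjective n π in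
          x , λ { refl j → proj₂ (F≋π j) ∘ permute-⊆ (decode n x) π x≈π j
                         , permute-⊆ π (decode n x) (sym ∘ x≈π) j ∘ proj₁ (F≋π j) })
    }
    where
    permute-⊆ : ∀ π σ → π ≈ᵖ σ → ∀ j → chain (permute γ π) j ⊆ chain (permute γ σ) j
    permute-⊆ π σ π≈σ j = K⟨⟩-mono λ (i , i<j , x≈) →
      i , i<j , ≈-trans x≈ (≈-reflexive (cong γ (π≈σ i)))

proposition2p8 : ∀ {a ℓ₁ b ℓ₂} (K : Field a ℓ₁) (K̄ : AlgebraicClosure K b ℓ₂) →
    let open AlgebraicClosure K̄
        open InClosure K̄
    in
    Perfect → (f : K[X]) → IrreducibleOverK f →
    (m : ℕ) (β : Fin m → Carrier) → (∀ i → β i ∈ Roots f) → Distinct β →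
    (IsMinimalGeneratingSet f (Image β) ⇔
      (∀ (π : Permutation′ m) → IsClusterTowerOfLength f (permute β π) m))
    ×
    (IsMinimalGeneratingSet f (Image β) →
      (∀ (π σ : Permutation′ m) → ¬ (π ≈ᵖ σ) →
        ¬ (chain (permute β π) ≋ chain (permute β σ)))
      × Bijection (≡-setoid (Fin (m !))) (towersOf β))
    ×
    (IsShortestMinimalGeneratingSet f (Image β) ⇔
      (IsClusterTowerOfLength f β m × IsLeastTowerLength f m))
proposition2p8 K K̄ _ f _ m β rts dis =
  mk⇔ (minimal⇒tower-permuted K̄ f dis)
      (λ towers → independent⇒minimal K̄ f rts
        (tower⇒generates K̄ f (proj₁ (towers idᵖ))) (towers⇒independent K̄ f towers)) ,
  (λ M → let ind = minimal⇒independent K̄ f dis M in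
    (λ π σ π≉σ eq → π≉σ (chains-determine-order K̄ ind π σ eq)) , towers-bijection K̄ ind) ,
  mk⇔ (λ B → minimal⇒tower K̄ f dis (IsShortest.isMinimalGeneratingSet B) , shortest⇒least K̄ f dis B)
      (λ ((T , _) , least) → least⇒shortest K̄ f T least)
  where module IsShortest = InClosure.IsShortestMinimalGeneratingSet
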